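{- Let $q\geq 3$ be an integer and let $k$ be an integer with $k\geq 94(q-1)$. Then the equation $s_q(n^2)=s_q(n)=k$ has infinitely many solutions in positive integers $n$ with $q\nmid n$ if and only if $k(k-1)\equiv 0 \pmod{q-1}$.
   Context: For an integer $q\geq 2$ and a nonnegative integer $m$, $s_q(m)$ denotes the sum of the digits of $m$ in its base-$q$ expansion. -}

module Defs where

open import Data.Nat using (ℕ; zero; suc; _+_; _*_; _∸_; _<_; _≤_; NonZero)
open import Data.Nat.DivMod using (_/_; _%_)
open import Data.Nat.Divisibility using (_∣_)
open import Data.Product using (Σ; _×_)
open import Relation.Nullary using (¬_)

-- Digit sum with fuel: digitSumFuel f q m sums base-q digits of m,
-- recursing at most f times. Fuel m suffices, since m / q < m for m > 0, q ≥ 2.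
digitSumFuel : ℕ → (q : ℕ) → .{{NonZero q}} → ℕ → ℕ
digitSumFuel zero    q m = 0
digitSumFuel (suc f) q zero = 0
digitSumFuel (suc f) q m@(suc _) = m % q + digitSumFuel f q (m / q)

-- s_q(m): sum of the base-q digits of m (meaningful for q ≥ 2).
s : (q : ℕ) → .{{NonZero q}} → ℕ → ℕ
s q m = digitSumFuel m q m

IsSolution : (q : ℕ) → .{{NonZero q}} → ℕ → ℕ → Set
IsSolution q k n = (0 < n) × (¬ (q ∣ n)) × (s q (n * n) ≡′ k) × (s q n ≡′ k)
  where open import Relation.Binary.PropositionalEquality renaming (_≡_ to _≡′_)

InfinitelyManySolutions : (q : ℕ) → .{{NonZero q}} → ℕ → Set
InfinitelyManySolutions q k = (N : ℕ) → Σ ℕ (λ n → (N < n) × IsSolution q k n)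

module Submission where

-- Write Q = q − 1. Since s_q(m) ≡ m (mod Q), a solution n satisfies k² ≡ n² ≡ k.
--
-- Conversely, choose 1 ≤ ε ≤ Q with ε ≡ 7 − k (mod Q), and with X = q^l put
--   P = A X⁴ + B X³ − ε X² + B X + D,   R = X² + X + 1,   n = R + Y P,
-- where A = q^a, B = q^b, D = q² and Y is any large power of X. Although P has a negative
-- coefficient, P², 2PR and R² have none, so for large l the digit sum of
-- n² = R² + Y (2PR) + Y² P² is the sum of the digit sums of their coefficients and does not
-- depend on l, whereas s_q(n) = 7 − ε + (l + b) Q. Each term of the form q^j − 2ε
-- contributes j Q − σ with σ = s_q(2ε − 1), and altogether
--   s_q(n²) = 36 + 2 s_q(3) + s_q(ε²) − 7 σ + (5 b + a + 2) Q.
-- With 2 ≤ a ≤ 6 the factor 5 b + a + 2 takes every large value, so a and b make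
-- s_q(n²) = k; then l makes s_q(n) = k, and Y remains free.

open import Defs
open import Data.Empty using (⊥-elim)
open import Data.List.Base using (List; []; _∷_; foldr; length; map)
open import Data.List.Relation.Unary.All using (All; []; _∷_)
open import Data.Nat
  using (ℕ; zero; suc; _+_; _*_; _∸_; _^_; _≤_; _<_; z≤n; s≤s; z<s; NonZero; >-nonZero)
open import Data.Nat.DivMod
open import Data.Nat.Divisibility
  using (_∣_; divides; ∣m+n∣m⇒∣n; m∣m*n; ∣m⇒∣m*n; ∣1⇒≡1)
open import Data.Nat.ListAction using (sum)
open import Data.Nat.Properties
open import Data.Nat.Tactic.RingSolver using (solve-∀)
open import Data.Product using (∃; _,_)
open import Function.Bundles using (_⇔_; mk⇔)
open import Relation.Binary.PropositionalEquality
  using (_≡_; refl; sym; trans; cong; cong₂; subst; subst₂; module ≡-Reasoning)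
open import Relation.Nullary using (¬_)

-- Polynomials given by coefficient lists

horner : ℕ → List ℕ → ℕ
horner X = foldr (λ c r → c + X * r) 0

horner-< : ∀ X cs → All (_< X) cs → horner X cs < X ^ length cs
horner-< X []       []       = z<s
horner-< X (c ∷ cs) (p ∷ ps) = begin-strict
  c + X * horner X cs   <⟨ +-monoˡ-< (X * horner X cs) p ⟩
  X + X * horner X cs   ≡⟨ *-suc X (horner X cs) ⟨
  X * suc (horner X cs) ≤⟨ *-monoʳ-≤ X (horner-< X cs ps) ⟩
  X * X ^ length cs     ∎
  where open ≤-Reasoning

-- Digit sums in base q

module DigitSum (Q : ℕ) (1≤Q : 1 ≤ Q) where

  q : ℕ
  q = suc Q

  -- `s` spends `m` units of fuel on `m`, but its recursive call on `m / q` inherits more fuel than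
  -- `s q (m / q)` receives. This bridges the gap and gives `s-unfold`.
  digitSumFuel-irrelevant : ∀ f g m → m ≤ f → m ≤ g →
    digitSumFuel f q m ≡ digitSumFuel g q m
  digitSumFuel-irrelevant zero    zero    zero    _ _ = refl
  digitSumFuel-irrelevant zero    (suc g) zero    _ _ = refl
  digitSumFuel-irrelevant (suc f) zero    zero    _ _ = refl
  digitSumFuel-irrelevant (suc f) (suc g) zero    _ _ = refl
  digitSumFuel-irrelevant (suc f) (suc g) (suc m) (s≤s m≤f) (s≤s m≤g) =
    cong (suc m % q +_)
      (digitSumFuel-irrelevant f g (suc m / q) (≤-trans m/q≤m m≤f) (≤-trans m/q≤m m≤g))
    where
    m/q≤m : suc m / q ≤ m
    m/q≤m = ≤-pred (m/n<m (suc m) q (s≤s 1≤Q))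

  s-unfold : ∀ m → s q m ≡ m % q + s q (m / q)
  s-unfold zero    = refl
  s-unfold (suc m) = cong (suc m % q +_)
    (digitSumFuel-irrelevant m (suc m / q) (suc m / q)
      (≤-pred (m/n<m (suc m) q (s≤s 1≤Q))) ≤-refl)

  s-cons : ∀ d m → d < q → s q (d + q * m) ≡ d + s q m
  s-cons d m d<q = begin
    s q (d + q * m)                              ≡⟨ cong (λ z → s q (d + z)) (*-comm q m) ⟩
    s q (d + m * q)                              ≡⟨ s-unfold (d + m * q) ⟩
    (d + m * q) % q + s q ((d + m * q) / q)      ≡⟨ cong₂ (λ x y → x + s q y) rem quo ⟩
    d + s q m                                    ∎
    where
    open ≡-Reasoning
    rem : (d + m * q) % q ≡ d
    rem = trans ([m+kn]%n≡m%n d m q) (m<n⇒m%n≡m d<q)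
    quo : (d + m * q) / q ≡ m
    quo = trans (+-distrib-/ d (m * q)
                  (subst (_< q) (sym (trans (cong₂ _+_ (m<n⇒m%n≡m d<q) (m*n%n≡0 m q)) (+-identityʳ d))) d<q))
                (cong₂ _+_ (m<n⇒m/n≡0 d<q) (m*n/n≡m m q))

  m≡m%q+q*[m/q] : ∀ m → m ≡ m % q + q * (m / q)
  m≡m%q+q*[m/q] m = trans (m≡m%n+[m/n]*n m q) (cong (m % q +_) (*-comm (m / q) q))

  /q-< : ∀ l {m} → m < q ^ suc l → m / q < q ^ l
  /q-< l {m} m< = m<n*o⇒m/o<n (subst (m <_) (*-comm q (q ^ l)) m<)

  -- The number `x` occupies only the lowest `l` places and `q ^ l * y` only the places above, so no
  -- carry occurs. The induction strips off the last digit of `x`.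
  s-append : ∀ l {x} y → x < q ^ l → s q (x + q ^ l * y) ≡ s q x + s q y
  s-append zero    {zero} y _ = cong (s q) (+-identityʳ y)
  s-append zero    {suc x} y (s≤s ())
  s-append (suc l) {x} y x< = begin
    s q (x + q * q ^ l * y)                 ≡⟨ cong (λ z → s q (z + q * q ^ l * y)) (m≡m%q+q*[m/q] x) ⟩
    s q (x % q + q * (x / q) + q * q ^ l * y) ≡⟨ cong (s q) (regroup (x % q) q (x / q) (q ^ l) y) ⟩
    s q (x % q + q * (x / q + q ^ l * y))   ≡⟨ s-cons (x % q) _ (m%n<n x q) ⟩
    x % q + s q (x / q + q ^ l * y)         ≡⟨ cong (x % q +_) (s-append l y (/q-< l x<)) ⟩
    x % q + (s q (x / q) + s q y)           ≡⟨ +-assoc (x % q) (s q (x / q)) (s q y) ⟨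
    x % q + s q (x / q) + s q y             ≡⟨ cong (_+ s q y) (s-unfold x) ⟨
    s q x + s q y                           ∎
    where
    open ≡-Reasoning
    regroup : ∀ d q x X y → d + q * x + q * X * y ≡ d + q * (x + X * y)
    regroup = solve-∀

  0<q^ : ∀ l → 0 < q ^ l
  0<q^ l = m^n>0 q l

  s-shift : ∀ l y → s q (q ^ l * y) ≡ s q y
  s-shift l y = s-append l y (0<q^ l)

  s-digit : ∀ {d} → d < q → s q d ≡ d
  s-digit {d} d<q = begin
    s q d           ≡⟨ cong (s q) (trans (cong (d +_) (*-zeroʳ q)) (+-identityʳ d)) ⟨
    s q (d + q * 0) ≡⟨ s-cons d 0 d<q ⟩
    d + 0           ≡⟨ +-identityʳ d ⟩
    d               ∎
    where open ≡-Reasoning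

  -- Casting out: q ≡ 1 (mod Q). The quotient is kept explicit so that the congruence can enter ring
  -- identities over ℕ.
  s-residue : ∀ m → ∃ λ r → m ≡ s q m + Q * r
  s-residue m = go m m ≤-refl
    where
    go : ∀ f m → m ≤ f → ∃ λ r → m ≡ s q m + Q * r
    go f       zero    _ = 0 , sym (*-zeroʳ Q)
    go (suc f) (suc m) (s≤s m≤f)
      with go f (suc m / q) (≤-trans (≤-pred (m/n<m (suc m) q (s≤s 1≤Q))) m≤f)
    ... | r , eq = r + suc m / q , (begin
      suc m                                    ≡⟨ m≡m%q+q*[m/q] (suc m) ⟩
      suc m % q + (suc m / q + Q * (suc m / q)) ≡⟨ cong (λ z → suc m % q + (z + Q * (suc m / q))) eq ⟩
      suc m % q + (s q (suc m / q) + Q * r + Q * (suc m / q))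
        ≡⟨ regroup (suc m % q) (s q (suc m / q)) Q r (suc m / q) ⟩
      suc m % q + s q (suc m / q) + Q * (r + suc m / q) ≡⟨ cong (_+ Q * (r + suc m / q)) (s-unfold (suc m)) ⟨
      s q (suc m) + Q * (r + suc m / q)        ∎)
      where
      open ≡-Reasoning
      regroup : ∀ d t Q r m → d + (t + Q * r + Q * m) ≡ d + t + Q * (r + m)
      regroup = solve-∀

  s≤ : ∀ m → s q m ≤ m
  s≤ m with s-residue m
  ... | r , eq = subst (s q m ≤_) (sym eq) (m≤m+n (s q m) (Q * r))

  -- From m < q follows m² < q², so the square has at most two digits.
  s[m*m]≤2Q : ∀ {m} → m ≤ Q → s q (m * m) ≤ 2 * Q
  s[m*m]≤2Q {m} m≤Q = begin
    s q (m * m)                         ≡⟨ s-unfold (m * m) ⟩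
    m * m % q + s q (m * m / q)         ≤⟨ +-mono-≤ (≤-pred (m%n<n (m * m) q)) (s≤ (m * m / q)) ⟩
    Q + m * m / q                       ≤⟨ +-monoʳ-≤ Q (≤-pred (m<n*o⇒m/o<n (*-mono-< (s≤s m≤Q) (s≤s m≤Q)))) ⟩
    Q + Q                               ≡⟨ cong (Q +_) (+-identityʳ Q) ⟨
    2 * Q                               ∎
    where open ≤-Reasoning

  -- Here z + x = q^a - 1, the number with `a` digits all equal to `Q`; hence the digits of `z` and
  -- `x` add up to `Q` at each of the `a` places. This is what evaluates every coefficient with a
  -- negative part.
  s-complement : ∀ a z x → z + suc x ≡ q ^ a → s q z + s q x ≡ a * Q
  s-complement zero    zero    zero    _ = refl
  s-complement zero    zero    (suc x) ()
  s-complement zero    (suc z) x       eq = ⊥-elim (m+1+n≢0 z (suc-injective eq))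
  s-complement (suc a) z x eq = begin
    s q z + s q x                                             ≡⟨ cong₂ _+_ (s-unfold z) (s-unfold x) ⟩
    z % q + s q (z / q) + (x % q + s q (x / q))               ≡⟨ regroup (z % q) _ (x % q) _ ⟩
    z % q + x % q + (s q (z / q) + s q (x / q))               ≡⟨ cong₂ _+_ low (s-complement a (z / q) (x / q) high) ⟩
    Q + a * Q                                                 ∎
    where
    open ≡-Reasoning
    regroup : ∀ a b c d → a + b + (c + d) ≡ a + c + (b + d)
    regroup = solve-∀
    expand : ∀ d z e x q → d + q * z + suc (e + q * x) ≡ suc (d + e) + q * (z + x)
    expand = solve-∀
    total : suc (z % q + x % q) + q * (z / q + x / q) ≡ q * q ^ a
    total = trans (sym (trans (cong₂ (λ u v → u + suc v) (m≡m%q+q*[m/q] z) (m≡m%q+q*[m/q] x))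
                              (expand (z % q) (z / q) (x % q) (x / q) q))) eq
    q∣ : q ∣ suc (z % q + x % q)
    q∣ = ∣m+n∣m⇒∣n (subst (q ∣_) (trans (sym total) (+-comm (suc (z % q + x % q)) _)) (m∣m*n (q ^ a)))
                   (m∣m*n (z / q + x / q))
    bound : suc (z % q + x % q) < 2 * q
    bound = subst (suc (suc (z % q + x % q)) ≤_) (cong (q +_) (sym (+-identityʳ q)))
      (subst (_≤ q + q) (cong suc (+-suc (z % q) (x % q))) (+-mono-≤ (m%n<n z q) (m%n<n x q)))
    -- A positive multiple of q below 2q can only be q.
    low′ : suc (z % q + x % q) ≡ q
    low′ with q∣
    ... | divides zero ()
    ... | divides (suc zero) e = trans e (+-identityʳ q)
    ... | divides (suc (suc k)) e =
      ⊥-elim (<⇒≱ bound (subst (2 * q ≤_) (sym e) (*-monoˡ-≤ q {2} {suc (suc k)} (s≤s (s≤s z≤n)))))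
    low : z % q + x % q ≡ Q
    low = suc-injective low′
    high : z / q + suc (x / q) ≡ q ^ a
    high = *-cancelˡ-≡ _ _ q (begin
      q * (z / q + suc (x / q))       ≡⟨ cong (q *_) (+-suc (z / q) (x / q)) ⟩
      q * suc (z / q + x / q)         ≡⟨ *-suc q (z / q + x / q) ⟩
      q + q * (z / q + x / q)         ≡⟨ cong (_+ q * (z / q + x / q)) low′ ⟨
      suc (z % q + x % q) + q * (z / q + x / q) ≡⟨ total ⟩
      q * q ^ a                       ∎)

  -- Coefficients below q^l fill disjoint blocks of `l` digits, so the total does not depend on `l`.
  s-horner : ∀ l cs → All (_< q ^ l) cs → s q (horner (q ^ l) cs) ≡ sum (map (s q) cs)
  s-horner l []       []       = refl
  s-horner l (c ∷ cs) (p ∷ ps) =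
    trans (s-append l (horner (q ^ l) cs) p) (cong (s q c +_) (s-horner l cs ps))

-- The polynomials P², 2PR and R²

-- P⁺(X) = P(X) + ε X²: the negative coefficient of P is moved across, so that all
-- identities below hold in ℕ without truncated subtraction.
P⁺ : (A B D X : ℕ) → ℕ
P⁺ A B D X = D + X * (B + X * (X * (B + X * A)))

-- Squaring P = P⁺ - ε X² gives P² + 2 ε X² P⁺ = P⁺² + ε² X⁴, in which nothing is subtracted. The
-- coefficients of X², X³, X⁵ and X⁶ are those that lose something; each hypothesis on a `c` puts
-- the loss on the other side.
P-square : ∀ {P ε A B D X c₂ c₃ c₅ c₆} →
  P + ε * (X * X) ≡ P⁺ A B D X →
  c₂ + 2 * ε * D ≡ B * B → c₃ + 2 * ε * B ≡ B * (D * 2) →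
  c₅ + 2 * ε * B ≡ B * (A * 2) → c₆ + 2 * ε * A ≡ B * B →
  P * P ≡ horner X
    (D * D ∷ B * (D * 2) ∷ c₂ ∷ c₃ ∷ ε * ε + (2 * (A * D) + 2 * (B * B)) ∷
     c₅ ∷ c₆ ∷ B * (A * 2) ∷ A * A ∷ [])
P-square {P} {ε} {A} {B} {D} {X} {c₂} {c₃} {c₅} {c₆} hP h₂ h₃ h₅ h₆ =
  +-cancelʳ-≡ (2 * ε * (X * X) * P⁺ A B D X) _ _ (begin
    P * P + 2 * ε * (X * X) * P⁺ A B D X
      ≡⟨ cong (λ p → P * P + 2 * ε * (X * X) * p) hP ⟨
    P * P + 2 * ε * (X * X) * (P + ε * (X * X))
      ≡⟨ complete P ε X ⟩
    (P + ε * (X * X)) * (P + ε * (X * X)) + ε * ε * (X * X * (X * X))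
      ≡⟨ cong (λ p → p * p + ε * ε * (X * X * (X * X))) hP ⟩
    P⁺ A B D X * P⁺ A B D X + ε * ε * (X * X * (X * X))
      ≡⟨ expand A B D ε X ⟩
    coefficients (B * B) (B * (D * 2)) (B * (A * 2)) (B * B)
      ≡⟨ cong₂ (λ x y → coefficients x y (B * (A * 2)) (B * B)) h₂ h₃ ⟨
    coefficients (c₂ + 2 * ε * D) (c₃ + 2 * ε * B) (B * (A * 2)) (B * B)
      ≡⟨ cong₂ (coefficients (c₂ + 2 * ε * D) (c₃ + 2 * ε * B)) h₅ h₆ ⟨
    coefficients (c₂ + 2 * ε * D) (c₃ + 2 * ε * B) (c₅ + 2 * ε * B) (c₆ + 2 * ε * A)
      ≡⟨ split (D * D) (B * (D * 2)) c₂ c₃ c₄ c₅ c₆ (B * (A * 2)) (A * A) A B D ε X ⟩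
    coefficients c₂ c₃ c₅ c₆ + 2 * ε * (X * X) * P⁺ A B D X ∎)
  where
  open ≡-Reasoning
  c₄ : ℕ
  c₄ = ε * ε + (2 * (A * D) + 2 * (B * B))
  coefficients : ℕ → ℕ → ℕ → ℕ → ℕ
  coefficients x y u v = horner X (D * D ∷ B * (D * 2) ∷ x ∷ y ∷ c₄ ∷ u ∷ v ∷ B * (A * 2) ∷ A * A ∷ [])
  complete : ∀ P ε X → P * P + 2 * ε * (X * X) * (P + ε * (X * X)) ≡
    (P + ε * (X * X)) * (P + ε * (X * X)) + ε * ε * (X * X * (X * X))
  complete = solve-∀
  expand : ∀ A B D ε X →
    (D + X * (B + X * (X * (B + X * A)))) * (D + X * (B + X * (X * (B + X * A)))) +
      ε * ε * (X * X * (X * X)) ≡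
    D * D + X * (B * (D * 2) + X * (B * B + X * (B * (D * 2) +
      X * (ε * ε + (2 * (A * D) + 2 * (B * B)) + X * (B * (A * 2) + X * (B * B +
      X * (B * (A * 2) + X * (A * A + X * 0))))))))
  expand = solve-∀
  split : ∀ c₀ c₁ c₂ c₃ c₄ c₅ c₆ c₇ c₈ A B D ε X →
    c₀ + X * (c₁ + X * (c₂ + 2 * ε * D + X * (c₃ + 2 * ε * B + X * (c₄ +
      X * (c₅ + 2 * ε * B + X * (c₆ + 2 * ε * A + X * (c₇ + X * (c₈ + X * 0)))))))) ≡
    c₀ + X * (c₁ + X * (c₂ + X * (c₃ + X * (c₄ + X * (c₅ + X * (c₆ + X * (c₇ + X * (c₈ + X * 0)))))))) +
      2 * ε * (X * X) * (D + X * (B + X * (X * (B + X * A))))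
  split = solve-∀

-- The same device with 2 ε X² R added to both sides. All coefficients of R are 1, so X², X³ and X⁴
-- lose 2 ε each.
P-cross : ∀ {P ε A B D X c₂ c₃ c₄} →
  P + ε * (X * X) ≡ P⁺ A B D X →
  c₂ + 2 * ε ≡ 2 * D + 2 * B → c₃ + 2 * ε ≡ B * 4 → c₄ + 2 * ε ≡ 2 * A + 2 * B →
  2 * (horner X (1 ∷ 1 ∷ 1 ∷ []) * P) ≡ horner X
    (D * 2 ∷ 2 * D + 2 * B ∷ c₂ ∷ c₃ ∷ c₄ ∷ 2 * A + 2 * B ∷ A * 2 ∷ [])
P-cross {P} {ε} {A} {B} {D} {X} {c₂} {c₃} {c₄} hP h₂ h₃ h₄ =
  +-cancelʳ-≡ (2 * ε * (X * X) * horner X (1 ∷ 1 ∷ 1 ∷ [])) _ _ (begin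
    2 * (horner X (1 ∷ 1 ∷ 1 ∷ []) * P) + 2 * ε * (X * X) * horner X (1 ∷ 1 ∷ 1 ∷ [])
      ≡⟨ factor (horner X (1 ∷ 1 ∷ 1 ∷ [])) P ε X ⟩
    2 * (horner X (1 ∷ 1 ∷ 1 ∷ []) * (P + ε * (X * X)))
      ≡⟨ cong (λ p → 2 * (horner X (1 ∷ 1 ∷ 1 ∷ []) * p)) hP ⟩
    2 * (horner X (1 ∷ 1 ∷ 1 ∷ []) * P⁺ A B D X)
      ≡⟨ expand A B D X ⟩
    coefficients (2 * D + 2 * B) (B * 4) (2 * A + 2 * B)
      ≡⟨ cong₂ (λ x y → coefficients x y (2 * A + 2 * B)) h₂ h₃ ⟨
    coefficients (c₂ + 2 * ε) (c₃ + 2 * ε) (2 * A + 2 * B)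
      ≡⟨ cong (coefficients (c₂ + 2 * ε) (c₃ + 2 * ε)) h₄ ⟨
    coefficients (c₂ + 2 * ε) (c₃ + 2 * ε) (c₄ + 2 * ε)
      ≡⟨ split (D * 2) (2 * D + 2 * B) c₂ c₃ c₄ (2 * A + 2 * B) (A * 2) ε X ⟩
    coefficients c₂ c₃ c₄ + 2 * ε * (X * X) * horner X (1 ∷ 1 ∷ 1 ∷ []) ∎)
  where
  open ≡-Reasoning
  coefficients : ℕ → ℕ → ℕ → ℕ
  coefficients x y z = horner X (D * 2 ∷ 2 * D + 2 * B ∷ x ∷ y ∷ z ∷ 2 * A + 2 * B ∷ A * 2 ∷ [])
  factor : ∀ R P ε X → 2 * (R * P) + 2 * ε * (X * X) * R ≡ 2 * (R * (P + ε * (X * X)))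
  factor = solve-∀
  expand : ∀ A B D X →
    2 * ((1 + X * (1 + X * (1 + X * 0))) * (D + X * (B + X * (X * (B + X * A))))) ≡
    D * 2 + X * (2 * D + 2 * B + X * (2 * D + 2 * B + X * (B * 4 + X * (2 * A + 2 * B +
      X * (2 * A + 2 * B + X * (A * 2 + X * 0))))))
  expand = solve-∀
  split : ∀ c₀ c₁ c₂ c₃ c₄ c₅ c₆ ε X →
    c₀ + X * (c₁ + X * (c₂ + 2 * ε + X * (c₃ + 2 * ε + X * (c₄ + 2 * ε + X * (c₅ + X * (c₆ + X * 0)))))) ≡
    c₀ + X * (c₁ + X * (c₂ + X * (c₃ + X * (c₄ + X * (c₅ + X * (c₆ + X * 0)))))) +
      2 * ε * (X * X) * (1 + X * (1 + X * (1 + X * 0)))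
  split = solve-∀

R-square : ∀ X → horner X (1 ∷ 1 ∷ 1 ∷ []) * horner X (1 ∷ 1 ∷ 1 ∷ []) ≡
  horner X (1 ∷ 2 ∷ 3 ∷ 2 ∷ 1 ∷ [])
R-square = expand
  where
  expand : ∀ X → (1 + X * (1 + X * (1 + X * 0))) * (1 + X * (1 + X * (1 + X * 0))) ≡
    1 + X * (2 + X * (3 + X * (2 + X * (1 + X * 0))))
  expand = solve-∀

-- `ξ` and `β` are X - ε and B - 1, the coefficients left after the negative term has borrowed one
-- X³ from B X³.
P-digits : ∀ {ε A B D X ξ β} → ξ + ε ≡ X → β + 1 ≡ B →
  horner X (D ∷ B ∷ ξ ∷ β ∷ A ∷ []) + ε * (X * X) ≡ P⁺ A B D X
P-digits {ε} {A} {_} {D} {_} {ξ} {β} refl refl = expand ε A β D ξ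
  where
  expand : ∀ ε A β D ξ → let X = ξ + ε; B = β + 1 in
    D + X * (B + X * (ξ + X * (β + X * (A + X * 0)))) + ε * (X * X) ≡
    D + X * (B + X * (X * (B + X * A)))
  expand = solve-∀

linear-combination : ∀ {L R l r} → l ≡ r → L + r ≡ R + l → L ≡ R
linear-combination {L} {R} {l} refl eq = +-cancelʳ-≡ l L R eq

-- With ε = e + 1: modulo Q it says z ≡ k − (e − 6)² ≡ k − k², since e − 6 ≡ −k.
residue-identity : ∀ {Q k e z σ t u w r₁ r₂ r₃ T} →
  z + (36 + 2 * t + u) ≡ k + 7 * σ →
  suc (2 * e) ≡ σ + Q * r₁ → 3 ≡ t + Q * r₂ → suc e * suc e ≡ u + Q * r₃ →
  k * k ≡ k + Q * w → k + e ≡ 6 + Q * T →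
  z + Q * (w + Q * T * T + 7 * r₁) ≡ Q * (2 * r₂ + r₃ + 2 * k * T)
residue-identity {Q} {k} {e} {z} {σ} {t} {u} {w} {r₁} {r₂} {r₃} {T} h₀ h₁ h₂ h₃ h₄ h₅ =
  linear-combination
    (cong₂ _+_ h₀ (cong₂ _+_ (cong (7 *_) (sym h₁)) (cong₂ _+_ (cong (2 *_) h₂)
      (cong₂ _+_ h₃ (cong₂ _+_ (sym h₄)
        (cong₂ _+_ (cong ((e + Q * T) *_) (sym h₅)) (cong ((6 + k) *_) h₅)))))))
    (identity Q k e z σ t u w r₁ r₂ r₃ T)
  where
  identity : ∀ Q k e z σ t u w r₁ r₂ r₃ T →
    z + Q * (w + Q * T * T + 7 * r₁) +
      (k + 7 * σ + (7 * (1 + 2 * e) + (2 * (t + Q * r₂) + (u + Q * r₃ +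
        (k * k + ((e + Q * T) * (k + e) + (6 + k) * (6 + Q * T))))))) ≡
    Q * (2 * r₂ + r₃ + 2 * k * T) +
      (z + (36 + 2 * t + u) + (7 * (σ + Q * r₁) + (2 * 3 + ((1 + e) * (1 + e) +
        (k + Q * w + ((e + Q * T) * (6 + Q * T) + (6 + k) * (k + e)))))))
  identity = solve-∀

-- Digit sums of the individual coefficients

module Construction (Q : ℕ) (2≤Q : 2 ≤ Q) (e : ℕ) (e<Q : e < Q) where

  open DigitSum Q (≤-trans (s≤s z≤n) 2≤Q)

  -- The argument of `σ` is 2 ε - 1, the complement of q^j - 2 ε with respect to q^j - 1.
  ε σ : ℕ
  ε = suc e
  σ = s q (suc (2 * e))

  1<q : 1 < q
  1<q = s≤s (≤-trans (s≤s z≤n) 2≤Q)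

  2<q : 2 < q
  2<q = s≤s 2≤Q

  s-power-digit : ∀ a {d} → d < q → s q (q ^ a * d) ≡ d
  s-power-digit a {d} d<q = trans (s-shift a d) (s-digit d<q)

  s-power : ∀ a → s q (q ^ a) ≡ 1
  s-power a = trans (cong (s q) (sym (*-identityʳ (q ^ a)))) (s-power-digit a 1<q)

  -- `x` stays below place `m`, the digit `d` stands at place `m` and the digit 2 at the higher
  -- place `n`. That 2 is a digit uses q ≥ 3.
  s-two-powers : ∀ {m n x d} → x < q ^ m → m < n → d < q →
    s q (x + (d * q ^ m + 2 * q ^ n)) ≡ s q x + (d + 2)
  s-two-powers {m} {n} {x} {d} x< m<n d<q = begin
    s q (x + (d * q ^ m + 2 * q ^ n))
      ≡⟨ cong (λ z → s q (x + (d * q ^ m + 2 * q ^ z))) (trans (sym (m+[n∸m]≡n m<n)) (sym (+-suc m j))) ⟩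
    s q (x + (d * q ^ m + 2 * q ^ (m + suc j)))
      ≡⟨ cong (λ z → s q (x + (d * q ^ m + 2 * z))) (^-distribˡ-+-* q m (suc j)) ⟩
    s q (x + (d * q ^ m + 2 * (q ^ m * (q * q ^ j))))
      ≡⟨ cong (λ z → s q (x + z)) (factor d (q ^ m) q (q ^ j)) ⟩
    s q (x + q ^ m * (d + q * (q ^ j * 2)))
      ≡⟨ s-append m _ x< ⟩
    s q x + s q (d + q * (q ^ j * 2))
      ≡⟨ cong (s q x +_) (s-cons d (q ^ j * 2) d<q) ⟩
    s q x + (d + s q (q ^ j * 2))
      ≡⟨ cong (λ z → s q x + (d + z)) (s-power-digit j 2<q) ⟩
    s q x + (d + 2) ∎
    where
    open ≡-Reasoning
    j = n ∸ suc m
    factor : ∀ d M q J → d * M + 2 * (M * (q * J)) ≡ M * (d + q * (J * 2))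
    factor = solve-∀

  m<q^m : ∀ m → m < q ^ m
  m<q^m zero    = z<s
  m<q^m (suc m) = begin-strict
    suc m         ≤⟨ m<q^m m ⟩
    q ^ m         <⟨ m<m*n (q ^ m) q {{>-nonZero (0<q^ m)}} 1<q ⟩
    q ^ m * q     ≡⟨ *-comm (q ^ m) q ⟩
    q ^ suc m     ∎
    where open ≤-Reasoning

  q∣q^ : ∀ {l} → 1 ≤ l → q ∣ q ^ l
  q∣q^ {suc l} _ = m∣m*n (q ^ l)

  -- Since ε ≤ Q < q, the square q² already suffices; this is why exponents start at 2 and D = q².
  2ε≤q^ : ∀ {a} → 2 ≤ a → 2 * ε ≤ q ^ a
  2ε≤q^ {a} 2≤a = begin
    2 * ε   ≤⟨ *-mono-≤ (<⇒≤ 2<q) (≤-trans e<Q (n≤1+n Q)) ⟩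
    q * q   ≡⟨ cong (q *_) (*-identityʳ q) ⟨
    q ^ 2   ≤⟨ ^-monoʳ-≤ q 2≤a ⟩
    q ^ a   ∎
    where open ≤-Reasoning

  comp : ℕ → ℕ
  comp a = q ^ a ∸ 2 * ε

  comp+2ε : ∀ {a} → 2 ≤ a → comp a + 2 * ε ≡ q ^ a
  comp+2ε 2≤a = m∸n+n≡m (2ε≤q^ 2≤a)

  comp< : ∀ {a} → 2 ≤ a → comp a < q ^ a
  comp< {a} 2≤a = subst (comp a <_) (comp+2ε 2≤a) (m<m+n (comp a) z<s)

  s-comp : ∀ {a} → 2 ≤ a → s q (comp a) + σ ≡ a * Q
  s-comp {a} 2≤a = s-complement a (comp a) (suc (2 * e))
    (trans (cong (comp a +_) (sym (*-suc 2 e))) (comp+2ε 2≤a))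

  module _ (a b : ℕ) (2≤a : 2 ≤ a) (a<b : a < b) where

    2≤b : 2 ≤ b
    2≤b = ≤-trans 2≤a (<⇒≤ a<b)

    -- The coefficients B² − 2εA, 2AB − 2εB, 2A + 2B − 2ε of P² and 2PR, where A = qᵃ and
    -- B = qᵇ; the choice a = 2 gives those with D in place of A.
    outer inner cross : ℕ
    outer = q ^ a * comp (b + b ∸ a)
    inner = q ^ b * (comp a + q ^ a * 1)
    cross = comp a + (1 * q ^ a + 2 * q ^ b)

    -- From a < b the exponent is at least b. It lets `comp` be applied after q^a has been taken out
    -- of B² - 2 ε A.
    2≤b+b∸a : 2 ≤ b + b ∸ a
    2≤b+b∸a = ≤-trans 2≤b (subst (_≤ b + b ∸ a) (m+n∸n≡m b b) (∸-monoʳ-≤ (b + b) (<⇒≤ a<b)))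

    a≤b+b : a ≤ b + b
    a≤b+b = ≤-trans (<⇒≤ a<b) (m≤m+n b b)

    outer+ : outer + 2 * ε * q ^ a ≡ q ^ b * q ^ b
    outer+ = begin
      q ^ a * comp (b + b ∸ a) + 2 * ε * q ^ a   ≡⟨ factor (q ^ a) _ (2 * ε) ⟩
      q ^ a * (comp (b + b ∸ a) + 2 * ε)         ≡⟨ cong (q ^ a *_) (comp+2ε 2≤b+b∸a) ⟩
      q ^ a * q ^ (b + b ∸ a)                    ≡⟨ ^-distribˡ-+-* q a (b + b ∸ a) ⟨
      q ^ (a + (b + b ∸ a))                      ≡⟨ cong (q ^_) (m+[n∸m]≡n a≤b+b) ⟩
      q ^ (b + b)                                ≡⟨ ^-distribˡ-+-* q b b ⟩
      q ^ b * q ^ b                              ∎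
      where
      open ≡-Reasoning
      factor : ∀ A c t → A * c + t * A ≡ A * (c + t)
      factor = solve-∀

    inner+ : inner + 2 * ε * q ^ b ≡ q ^ b * (q ^ a * 2)
    inner+ = begin
      q ^ b * (comp a + q ^ a * 1) + 2 * ε * q ^ b ≡⟨ factor (q ^ b) (comp a) (q ^ a) (2 * ε) ⟩
      q ^ b * (comp a + 2 * ε + q ^ a)             ≡⟨ cong (λ z → q ^ b * (z + q ^ a)) (comp+2ε 2≤a) ⟩
      q ^ b * (q ^ a + q ^ a)                      ≡⟨ cong (q ^ b *_) (double (q ^ a)) ⟩
      q ^ b * (q ^ a * 2)                          ∎
      where
      open ≡-Reasoning
      factor : ∀ B c A t → B * (c + A * 1) + t * B ≡ B * (c + t + A)
      factor = solve-∀
      double : ∀ A → A + A ≡ A * 2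
      double = solve-∀

    cross+ : cross + 2 * ε ≡ 2 * q ^ a + 2 * q ^ b
    cross+ = begin
      comp a + (1 * q ^ a + 2 * q ^ b) + 2 * ε     ≡⟨ regroup (comp a) (q ^ a) (q ^ b) (2 * ε) ⟩
      comp a + 2 * ε + q ^ a + 2 * q ^ b           ≡⟨ cong (λ z → z + q ^ a + 2 * q ^ b) (comp+2ε 2≤a) ⟩
      q ^ a + q ^ a + 2 * q ^ b                    ≡⟨ cong (λ z → q ^ a + z + 2 * q ^ b) (+-identityʳ (q ^ a)) ⟨
      2 * q ^ a + 2 * q ^ b                        ∎
      where
      open ≡-Reasoning
      regroup : ∀ c A B t → c + (1 * A + 2 * B) + t ≡ c + t + A + 2 * B
      regroup = solve-∀

    s-outer : s q outer + σ ≡ (b + b ∸ a) * Q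
    s-outer = trans (cong (_+ σ) (s-shift a _)) (s-comp 2≤b+b∸a)

    -- In 2 A - 2 ε one copy of A absorbs -2 ε and stays below place `a`, and the other is a digit 1
    -- at place `a`.
    s-inner : s q inner ≡ s q (comp a) + 1
    s-inner = begin
      s q (q ^ b * (comp a + q ^ a * 1)) ≡⟨ s-shift b _ ⟩
      s q (comp a + q ^ a * 1)           ≡⟨ s-append a 1 (comp< 2≤a) ⟩
      s q (comp a) + s q 1               ≡⟨ cong (s q (comp a) +_) (s-digit 1<q) ⟩
      s q (comp a) + 1                   ∎
      where open ≡-Reasoning

    s-cross : s q cross ≡ s q (comp a) + 3
    s-cross = s-two-powers (comp< 2≤a) a<b 1<q

    s-2a+2b : s q (2 * q ^ a + 2 * q ^ b) ≡ 4
    s-2a+2b = s-two-powers {x = 0} (0<q^ a) a<b 2<q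

  -- The number n, its square and both digit sums

  module Solution (a b l N : ℕ) (2≤a : 2 ≤ a) (a<b : a < b) (2<b : 2 < b)
                  (a+2<b+b : a + 2 < b + b) (l-large : 2 + (b + b) ≤ l) where

    A B D X Y P R n : ℕ
    A = q ^ a
    B = q ^ b
    D = q ^ 2
    X = q ^ l
    -- R² has five and 2PR has seven coefficients, all below X, so both are below X⁷ and hence below
    -- Y. The summand `N` makes n exceed `N`.
    Y = X ^ (7 + N)
    P = horner X (D ∷ B ∷ X ∸ ε ∷ B ∸ 1 ∷ A ∷ [])
    R = horner X (1 ∷ 1 ∷ 1 ∷ [])
    n = R + Y * P

    -- The coefficient of X⁴ in P², and that of X³ in 2PR, namely 4 B - 2 ε.
    c₄ e₃ : ℕ
    c₄ = ε * ε + (2 * (A * D) + 2 * (B * B))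
    e₃ = comp b + B * 3

    RR RP PP : List ℕ
    RR = 1 ∷ 2 ∷ 3 ∷ 2 ∷ 1 ∷ []
    RP = D * 2 ∷ 2 * D + 2 * B ∷ cross 2 b ≤-refl 2<b ∷ e₃ ∷ cross a b 2≤a a<b ∷ 2 * A + 2 * B ∷ A * 2 ∷ []
    PP = D * D ∷ B * (D * 2) ∷ outer 2 b ≤-refl 2<b ∷ inner 2 b ≤-refl 2<b ∷ c₄ ∷
         inner a b 2≤a a<b ∷ outer a b 2≤a a<b ∷ B * (A * 2) ∷ A * A ∷ []

    2≤b′ : 2 ≤ b
    2≤b′ = <⇒≤ 2<b

    e₃+ : e₃ + 2 * ε ≡ B * 4
    e₃+ = trans (regroup (comp b) B (2 * ε)) (trans (cong (_+ B * 3) (comp+2ε 2≤b′)) (sym (*-suc B 3)))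
      where
      regroup : ∀ c B t → c + B * 3 + t ≡ c + t + B * 3
      regroup = solve-∀

    ε≤q^ : ∀ {j} → 2 ≤ j → ε ≤ q ^ j
    ε≤q^ 2≤j = ≤-trans (m≤m+n ε (1 * ε)) (2ε≤q^ 2≤j)

    2≤l : 2 ≤ l
    2≤l = ≤-trans (m≤m+n 2 (b + b)) l-large

    ξ+ε : X ∸ ε + ε ≡ X
    ξ+ε = m∸n+n≡m (ε≤q^ 2≤l)

    β+1 : B ∸ 1 + 1 ≡ B
    β+1 = m∸n+n≡m (0<q^ b)

    P+εX² : P + ε * (X * X) ≡ P⁺ A B D X
    P+εX² = P-digits {ε} {A} {B} {D} {X} ξ+ε β+1

    n² : n * n ≡ horner X RR + Y * (horner X RP + Y * horner X PP)
    n² = begin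
      (R + Y * P) * (R + Y * P)                    ≡⟨ expand R Y P ⟩
      R * R + Y * (2 * (R * P) + Y * (P * P))
        ≡⟨ cong₂ (λ x y → R * R + Y * (x + Y * y))
             (P-cross {P} {ε} {A} {B} {D} {X} P+εX² (cross+ 2 b ≤-refl 2<b) e₃+ (cross+ a b 2≤a a<b))
             (P-square {P} {ε} {A} {B} {D} {X} P+εX² (outer+ 2 b ≤-refl 2<b) (inner+ 2 b ≤-refl 2<b)
                       (inner+ a b 2≤a a<b) (outer+ a b 2≤a a<b)) ⟩
      R * R + Y * (horner X RP + Y * horner X PP)
        ≡⟨ cong (λ x → x + Y * (horner X RP + Y * horner X PP)) (R-square X) ⟩
      horner X RR + Y * (horner X RP + Y * horner X PP) ∎
      where
      open ≡-Reasoning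
      expand : ∀ R Y P → (R + Y * P) * (R + Y * P) ≡ R * R + Y * (2 * (R * P) + Y * (P * P))
      expand = solve-∀

    BB : ℕ
    BB = B * B

    -- No coefficient exceeds 5 B², the bound used for `c₄`. As 5 < 9 ≤ q², the condition 2 + 2 b ≤
    -- l is enough.
    5BB<X : 5 * BB < X
    5BB<X = begin-strict
      5 * BB             <⟨ *-monoˡ-< BB {{>-nonZero (*-mono-≤ (0<q^ b) (0<q^ b))}} {5} {9} (s≤s (s≤s (s≤s (s≤s (s≤s (s≤s z≤n)))))) ⟩
      9 * BB             ≤⟨ *-monoˡ-≤ BB (*-mono-≤ 2<q 2<q) ⟩
      q * q * BB         ≡⟨ cong (q * q *_) (^-distribˡ-+-* q b b) ⟨
      q * q * q ^ (b + b) ≡⟨ *-assoc q q (q ^ (b + b)) ⟩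
      q ^ (2 + (b + b))  ≤⟨ ^-monoʳ-≤ q l-large ⟩
      X                  ∎
      where open ≤-Reasoning

    bounded : ∀ m {c} → c ≤ m * BB → m ≤ 5 → c < X
    bounded m c≤ m≤5 = ≤-<-trans (≤-trans c≤ (*-monoˡ-≤ BB m≤5)) 5BB<X

    D≤B : D ≤ B
    D≤B = ^-monoʳ-≤ q 2≤b′

    A≤B : A ≤ B
    A≤B = ^-monoʳ-≤ q (<⇒≤ a<b)

    1≤B : 1 ≤ B
    1≤B = 0<q^ b

    linear-bound : ∀ {c} → c ≤ B → c ≤ 1 * BB
    linear-bound {c} c≤B =
      subst₂ _≤_ (*-identityʳ c) (sym (+-identityʳ BB)) (*-mono-≤ c≤B 1≤B)

    product-bound : ∀ {u v} → u ≤ B → v ≤ B → u * v ≤ 1 * BB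
    product-bound {u} {v} u≤B v≤B = subst (u * v ≤_) (sym (+-identityʳ BB)) (*-mono-≤ u≤B v≤B)

    scale-bound : ∀ m {c} → c ≤ 1 * BB → m * c ≤ m * BB
    scale-bound m {c} c≤ = *-monoʳ-≤ m (subst (c ≤_) (+-identityʳ BB) c≤)

    sum-bound : ∀ m m′ {c c′} → c ≤ m * BB → c′ ≤ m′ * BB → c + c′ ≤ (m + m′) * BB
    sum-bound m m′ {c} {c′} c≤ c′≤ = subst (c + c′ ≤_) (sym (*-distribʳ-+ BB m m′)) (+-mono-≤ c≤ c′≤)

    difference-bound : ∀ m {c t p} → c + t ≡ p → p ≤ m * BB → c ≤ m * BB
    difference-bound m refl p≤ = ≤-trans (m≤m+n _ _) p≤

    double-bound : ∀ {c} → c ≤ B → c * 2 ≤ 2 * BB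
    double-bound {c} c≤B = subst (_≤ 2 * BB) (*-comm 2 c) (scale-bound 2 (linear-bound c≤B))

    double-product-bound : ∀ {c} → c ≤ B → B * (c * 2) ≤ 2 * BB
    double-product-bound {c} c≤B =
      subst (_≤ 2 * BB) (regroup B c) (scale-bound 2 (product-bound ≤-refl c≤B))
      where
      regroup : ∀ B c → 2 * (B * c) ≡ B * (c * 2)
      regroup = solve-∀

    double-sum-bound : ∀ {c} → c ≤ B → 2 * c + 2 * B ≤ 4 * BB
    double-sum-bound c≤B =
      sum-bound 2 2 (scale-bound 2 (linear-bound c≤B)) (scale-bound 2 (linear-bound ≤-refl))

    1≤5 : 1 ≤ 5
    1≤5 = m≤m+n 1 4

    2≤5 : 2 ≤ 5
    2≤5 = m≤m+n 2 3

    4≤5 : 4 ≤ 5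
    4≤5 = n≤1+n 4

    RR< : All (_< X) RR
    RR< = d 1 1≤5 ∷ d 2 2≤5 ∷ d 3 (s≤s (s≤s (s≤s z≤n))) ∷ d 2 2≤5 ∷ d 1 1≤5 ∷ []
      where
      d : ∀ m → m ≤ 5 → m < X
      d m m≤5 = bounded m (subst (_≤ m * BB) (*-identityʳ m) (scale-bound m (linear-bound 1≤B))) m≤5

    RP< : All (_< X) RP
    RP< =
      bounded 2 (double-bound D≤B) 2≤5 ∷
      bounded 4 (double-sum-bound D≤B) 4≤5 ∷
      bounded 4 (difference-bound 4 (cross+ 2 b ≤-refl 2<b) (double-sum-bound D≤B)) 4≤5 ∷
      bounded 4 (difference-bound 4 e₃+
        (subst (_≤ 4 * BB) (*-comm 4 B) (scale-bound 4 (linear-bound ≤-refl)))) 4≤5 ∷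
      bounded 4 (difference-bound 4 (cross+ a b 2≤a a<b) (double-sum-bound A≤B)) 4≤5 ∷
      bounded 4 (double-sum-bound A≤B) 4≤5 ∷
      bounded 2 (double-bound A≤B) 2≤5 ∷ []

    PP< : All (_< X) PP
    PP< =
      bounded 1 (product-bound D≤B D≤B) 1≤5 ∷
      bounded 2 (double-product-bound D≤B) 2≤5 ∷
      bounded 1 (difference-bound 1 (outer+ 2 b ≤-refl 2<b) (product-bound ≤-refl ≤-refl)) 1≤5 ∷
      bounded 2 (difference-bound 2 (inner+ 2 b ≤-refl 2<b) (double-product-bound D≤B)) 2≤5 ∷
      bounded 5 (sum-bound 1 4 (product-bound (ε≤q^ 2≤b′) (ε≤q^ 2≤b′))
        (sum-bound 2 2 (scale-bound 2 (product-bound A≤B D≤B))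
                       (scale-bound 2 (product-bound ≤-refl ≤-refl)))) ≤-refl ∷
      bounded 2 (difference-bound 2 (inner+ a b 2≤a a<b) (double-product-bound A≤B)) 2≤5 ∷
      bounded 1 (difference-bound 1 (outer+ a b 2≤a a<b) (product-bound ≤-refl ≤-refl)) 1≤5 ∷
      bounded 2 (double-product-bound A≤B) 2≤5 ∷
      bounded 1 (product-bound A≤B A≤B) 1≤5 ∷ []

    -- AD and B² are the powers with exponents a + 2 < 2 b, and ε² < q² lies below both, so two
    -- digits 2 are added.
    s-c₄ : s q c₄ ≡ s q (ε * ε) + 4
    s-c₄ = begin
      s q (ε * ε + (2 * (A * D) + 2 * (B * B)))
        ≡⟨ cong₂ (λ x y → s q (ε * ε + (2 * x + 2 * y))) (^-distribˡ-+-* q a 2) (^-distribˡ-+-* q b b) ⟨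
      s q (ε * ε + (2 * q ^ (a + 2) + 2 * q ^ (b + b)))
        ≡⟨ s-two-powers ε²< a+2<b+b 2<q ⟩
      s q (ε * ε) + 4 ∎
      where
      open ≡-Reasoning
      ε²< : ε * ε < q ^ (a + 2)
      ε²< = <-≤-trans (*-mono-< (s≤s e<Q) (s≤s e<Q))
        (≤-trans (≤-reflexive (cong (q *_) (sym (*-identityʳ q)))) (^-monoʳ-≤ q (m≤n+m 2 a)))

    -- `s q 3` is left unevaluated, because 3 is not a digit when q = 3.
    s-e₃ : s q e₃ ≡ s q (comp b) + s q 3
    s-e₃ = s-append b 3 (comp< 2≤b′)

    s-RR : sum (map (s q) RR) ≡ 6 + s q 3
    s-RR = trans (cong₂ (λ x y → x + (y + (s q 3 + (y + (x + 0))))) (s-digit 1<q) (s-digit 2<q))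
                 (regroup (s q 3))
      where
      regroup : ∀ t → 1 + (2 + (t + (2 + (1 + 0)))) ≡ 6 + t
      regroup = solve-∀

    s-RP : sum (map (s q) RP) ≡
      18 + s q 3 + (s q (comp 2) + s q (comp b) + s q (comp a))
    s-RP = trans
      (cong₂ _+_ (s-power-digit 2 2<q) (cong₂ _+_ (s-2a+2b 2 b ≤-refl 2<b)
        (cong₂ _+_ (s-cross 2 b ≤-refl 2<b) (cong₂ _+_ s-e₃ (cong₂ _+_ (s-cross a b 2≤a a<b)
          (cong₂ _+_ (s-2a+2b a b 2≤a a<b) (cong (_+ 0) (s-power-digit a 2<q))))))))
      (regroup (s q 3) (s q (comp 2)) (s q (comp b)) (s q (comp a)))
      where
      regroup : ∀ t x y z → 2 + (4 + (x + 3 + (y + t + (z + 3 + (4 + (2 + 0)))))) ≡ 18 + t + (x + y + z)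
      regroup = solve-∀

    s-PP : sum (map (s q) PP) ≡
      12 + s q (ε * ε) + (s q (comp 2) + s q (comp a) +
        (s q (outer 2 b ≤-refl 2<b) + s q (outer a b 2≤a a<b)))
    s-PP = trans
      (cong₂ _+_ (trans (s-shift 2 D) (s-power 2)) (cong₂ _+_ (double-product 2)
        (cong₂ _+_ (refl {x = s q (outer 2 b ≤-refl 2<b)}) (cong₂ _+_ (s-inner 2 b ≤-refl 2<b) (cong₂ _+_ s-c₄
          (cong₂ _+_ (s-inner a b 2≤a a<b) (cong₂ _+_ (refl {x = s q (outer a b 2≤a a<b)})
            (cong₂ _+_ (double-product a) (cong (_+ 0) (trans (s-shift a A) (s-power a)))))))))))
      (regroup (s q (ε * ε)) (s q (comp 2)) (s q (comp a)) (s q (outer 2 b ≤-refl 2<b)) (s q (outer a b 2≤a a<b)))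
      where
      double-product : ∀ j → s q (B * (q ^ j * 2)) ≡ 2
      double-product j = trans (s-shift b _) (s-power-digit j 2<q)
      regroup : ∀ u x y v w →
        1 + (2 + (v + (x + 1 + (u + 4 + (y + 1 + (w + (2 + (1 + 0)))))))) ≡ 12 + u + (x + y + (v + w))
      regroup = solve-∀

    Y≡ : Y ≡ q ^ (l * (7 + N))
    Y≡ = ^-*-assoc q l (7 + N)

    s-appendY : ∀ {x} y → x < Y → s q (x + Y * y) ≡ s q x + s q y
    s-appendY {x} y x<Y = subst (λ Z → s q (x + Z * y) ≡ s q x + s q y) (sym Y≡)
      (s-append (l * (7 + N)) y (subst (x <_) Y≡ x<Y))

    horner<Y : ∀ cs → All (_< X) cs → length cs ≤ 7 → horner X cs < Y
    horner<Y cs cs< ≤7 = <-≤-trans (horner-< X cs cs<)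
      (^-monoʳ-≤ X {{>-nonZero (0<q^ l)}} (≤-trans ≤7 (m≤m+n 7 N)))

    s-n² : s q (n * n) + 7 * σ ≡ 36 + 2 * s q 3 + s q (ε * ε) + (5 * b + a + 2) * Q
    s-n² = begin
      s q (n * n) + 7 * σ
        ≡⟨ cong (λ x → s q x + 7 * σ) n² ⟩
      s q (horner X RR + Y * (horner X RP + Y * horner X PP)) + 7 * σ
        ≡⟨ cong (_+ 7 * σ) (s-appendY _ (horner<Y RR RR< (s≤s (s≤s (s≤s (s≤s (s≤s z≤n))))))) ⟩
      s q (horner X RR) + s q (horner X RP + Y * horner X PP) + 7 * σ
        ≡⟨ cong (λ x → s q (horner X RR) + x + 7 * σ) (s-appendY _ (horner<Y RP RP< ≤-refl)) ⟩
      s q (horner X RR) + (s q (horner X RP) + s q (horner X PP)) + 7 * σ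
        ≡⟨ cong₂ (λ x y → x + y + 7 * σ) (trans (s-horner l RR RR<) s-RR)
             (cong₂ _+_ (trans (s-horner l RP RP<) s-RP) (trans (s-horner l PP PP<) s-PP)) ⟩
      6 + s q 3 + (18 + s q 3 + (x + y + z) + (12 + s q (ε * ε) + (x + z + (v + w)))) + 7 * σ
        -- Seven coefficients lose a multiple of 2 ε, so each `σ` completes one of them. The
        -- exponents then sum to 2·2 + b + 2 a + (2 b - 2) + (2 b - a) = 5 b + a + 2.
        ≡⟨ regroup (s q 3) (s q (ε * ε)) x y z v w σ ⟩
      36 + 2 * s q 3 + s q (ε * ε) + (2 * (x + σ) + (y + σ) + 2 * (z + σ) + ((v + σ) + (w + σ)))
        ≡⟨ cong (36 + 2 * s q 3 + s q (ε * ε) +_)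
             (cong₂ _+_ (cong₂ _+_ (cong₂ (λ x y → 2 * x + y) (s-comp ≤-refl) (s-comp 2≤b′))
                               (cong (2 *_) (s-comp 2≤a)))
               (cong₂ _+_ (s-outer 2 b ≤-refl 2<b) (s-outer a b 2≤a a<b))) ⟩
      36 + 2 * s q 3 + s q (ε * ε) +
        (2 * (2 * Q) + b * Q + 2 * (a * Q) + ((b + b ∸ 2) * Q + (b + b ∸ a) * Q))
        ≡⟨ cong (36 + 2 * s q 3 + s q (ε * ε) +_) (collect (b + b ∸ 2) (b + b ∸ a)
             (m+[n∸m]≡n (a≤b+b 2 b ≤-refl 2<b)) (m+[n∸m]≡n (a≤b+b a b 2≤a a<b))) ⟩
      36 + 2 * s q 3 + s q (ε * ε) + (5 * b + a + 2) * Q ∎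
      where
      open ≡-Reasoning
      x = s q (comp 2)
      y = s q (comp b)
      z = s q (comp a)
      v = s q (outer 2 b ≤-refl 2<b)
      w = s q (outer a b 2≤a a<b)
      regroup : ∀ t u x y z v w σ →
        6 + t + (18 + t + (x + y + z) + (12 + u + (x + z + (v + w)))) + 7 * σ ≡
        36 + 2 * t + u + (2 * (x + σ) + (y + σ) + 2 * (z + σ) + ((v + σ) + (w + σ)))
      regroup = solve-∀
      collect : ∀ g h → 2 + g ≡ b + b → a + h ≡ b + b →
        2 * (2 * Q) + b * Q + 2 * (a * Q) + (g * Q + h * Q) ≡ (5 * b + a + 2) * Q
      collect g h hg hh = trans (group Q b a g h)
        (trans (cong₂ (λ i j → (2 + b + a + i + j) * Q) hg hh) (finish Q b a))
        where
        group : ∀ Q b a g h → 2 * (2 * Q) + b * Q + 2 * (a * Q) + (g * Q + h * Q) ≡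
          (2 + b + a + (2 + g) + (a + h)) * Q
        group = solve-∀
        finish : ∀ Q b a → (2 + b + a + (b + b) + (b + b)) * Q ≡ (5 * b + a + 2) * Q
        finish = solve-∀

    -- −ε X² + B X³ is written as (X − ε) X² + (B − 1) X³, so that the coefficients of P
    -- become base-X digits.
    P-digits< : All (_< X) (D ∷ B ∷ X ∸ ε ∷ B ∸ 1 ∷ A ∷ [])
    P-digits< = B-bound D≤B ∷ B-bound ≤-refl ∷ subst (X ∸ ε <_) ξ+ε (m<m+n (X ∸ ε) z<s) ∷
      B-bound (m∸n≤m B 1) ∷ B-bound A≤B ∷ []
      where
      B-bound : ∀ {c} → c ≤ B → c < X
      B-bound c≤B = bounded 1 (linear-bound c≤B) 1≤5

    -- R contributes 3 and D, B, A contribute 1 each. X - ε is the complement of `e` in `l` places,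
    -- and B - 1 consists of `b` digits `Q`.
    s-n : s q n + e ≡ 6 + (l + b) * Q
    s-n = begin
      s q (R + Y * P) + e
        ≡⟨ cong (_+ e) (s-appendY P (horner<Y (1 ∷ 1 ∷ 1 ∷ []) (one ∷ one ∷ one ∷ []) (s≤s (s≤s (s≤s z≤n))))) ⟩
      s q R + s q P + e
        ≡⟨ cong₂ (λ x y → x + y + e) (s-horner l (1 ∷ 1 ∷ 1 ∷ []) (one ∷ one ∷ one ∷ [])) (s-horner l _ P-digits<) ⟩
      s q 1 + (s q 1 + (s q 1 + 0)) + (s q D + (s q B + (s q (X ∸ ε) + (s q (B ∸ 1) + (s q A + 0))))) + e
        ≡⟨ cong₂ (λ x y → x + (x + (x + 0)) + (y + (s q B + (s q (X ∸ ε) + (s q (B ∸ 1) + (s q A + 0))))) + e)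
             (s-digit 1<q) (s-power 2) ⟩
      3 + (1 + (s q B + (s q (X ∸ ε) + (s q (B ∸ 1) + (s q A + 0))))) + e
        ≡⟨ cong₂ (λ x y → 3 + (1 + (x + (s q (X ∸ ε) + (s q (B ∸ 1) + (y + 0))))) + e) (s-power b) (s-power a) ⟩
      3 + (1 + (1 + (s q (X ∸ ε) + (s q (B ∸ 1) + (1 + 0))))) + e
        ≡⟨ regroup (s q (X ∸ ε)) (s q (B ∸ 1)) e ⟩
      6 + (s q (X ∸ ε) + e + (s q (B ∸ 1) + 0))
        ≡⟨ cong (λ x → 6 + (s q (X ∸ ε) + x + (s q (B ∸ 1) + 0))) (s-digit (≤-trans e<Q (n≤1+n Q))) ⟨
      6 + (s q (X ∸ ε) + s q e + (s q (B ∸ 1) + 0))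
        ≡⟨ cong₂ (λ x y → 6 + (x + y)) (s-complement l (X ∸ ε) e ξ+ε) (s-complement b (B ∸ 1) 0 β+1) ⟩
      6 + (l * Q + b * Q)
        ≡⟨ cong (6 +_) (*-distribʳ-+ Q l b) ⟨
      6 + (l + b) * Q ∎
      where
      open ≡-Reasoning
      one : 1 < X
      one = bounded 1 (linear-bound 1≤B) 1≤5
      regroup : ∀ x y e → 3 + (1 + (1 + (x + (y + (1 + 0))))) + e ≡ 6 + (x + e + (y + 0))
      regroup = solve-∀

    -- n is 1 plus a multiple of X, and q divides X.
    q∤n : ¬ (q ∣ n)
    q∤n q∣n = <⇒≢ 1<q (sym (∣1⇒≡1 (∣m+n∣m⇒∣n (subst (q ∣_) (regroup X (X ^ (6 + N)) P) q∣n) (∣m⇒∣m*n _ (q∣q^ (≤-trans (n≤1+n 1) 2≤l))))))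
      where
      regroup : ∀ X Z P → 1 + X * (1 + X * (1 + X * 0)) + X * Z * P ≡
        X * (1 + X * (1 + X * 0) + Z * P) + 1
      regroup = solve-∀

    N<n : N < n
    N<n = begin-strict
      N                 ≤⟨ m≤n+m N 7 ⟩
      7 + N             ≡⟨ *-identityˡ (7 + N) ⟨
      1 * (7 + N)       ≤⟨ *-monoˡ-≤ (7 + N) (≤-trans (n≤1+n 1) 2≤l) ⟩
      l * (7 + N)       <⟨ m<q^m (l * (7 + N)) ⟩
      q ^ (l * (7 + N)) ≡⟨ Y≡ ⟨
      Y                 ≡⟨ *-identityʳ Y ⟨
      Y * 1             ≤⟨ *-monoʳ-≤ Y (≤-trans (0<q^ 2) (m≤m+n D _)) ⟩
      Y * P             ≤⟨ m≤n+m (Y * P) R ⟩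
      n                 ∎
      where open ≤-Reasoning

-- Divisibility by Q and the choice of a, b and l

k*k≡k+k*[k∸1] : ∀ k → k * k ≡ k + k * (k ∸ 1)
k*k≡k+k*[k∸1] zero    = refl
k*k≡k+k*[k∸1] (suc k) = *-suc (suc k) k

-- `z` is what remains of k for (5 b + a + 2) Q once the constant terms of `s-n²` are accounted for,
-- so it has to be a multiple of `Q`.
Q∣k+7σ-C : ∀ {Q k e z σ t u T} → Q ∣ k * (k ∸ 1) →
  (∃ λ r → suc (2 * e) ≡ σ + Q * r) → (∃ λ r → 3 ≡ t + Q * r) →
  (∃ λ r → suc e * suc e ≡ u + Q * r) →
  k + e ≡ 6 + T * Q → z + (36 + 2 * t + u) ≡ k + 7 * σ → Q ∣ z
Q∣k+7σ-C {Q} {k} {e} {z} {σ} {t} {u} {T} (divides w k[k-1]≡) (r₁ , h₁) (r₂ , h₂) (r₃ , h₃) k+e z+C =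
  ∣m+n∣m⇒∣n
    (subst (Q ∣_)
      (trans (sym (residue-identity {Q} {k} {e} {z} {σ} {t} {u} {w} {r₁} {r₂} {r₃} {T}
        z+C h₁ h₂ h₃ k²≡ k+e′)) (+-comm z _))
      (m∣m*n (2 * r₂ + r₃ + 2 * k * T)))
    (m∣m*n (w + Q * T * T + 7 * r₁))
  where
  k²≡ : k * k ≡ k + Q * w
  k²≡ = trans (k*k≡k+k*[k∸1] k) (cong (k +_) (trans k[k-1]≡ (*-comm w Q)))
  k+e′ : k + e ≡ 6 + Q * T
  k+e′ = trans k+e (cong (6 +_) (*-comm T Q))

-- M and T stand for 5 b + a + 2 and l + b.
module Parameters
  {Q k e z C σ T M : ℕ} .{{_ : NonZero Q}}
  (94Q≤k : 94 * Q ≤ k) (k+e : k + e ≡ 6 + T * Q) (z+C : z + C ≡ k + 7 * σ) (z≡ : z ≡ M * Q)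
  (6≤C : 6 ≤ C) (C≤23Q : C ≤ 23 * Q) (σ≤2Q : σ ≤ 2 * Q) where

  -- Division of M - 4 by 5 leaves a - 2 as remainder, whence 2 ≤ a ≤ 6.
  a b : ℕ
  a = (M ∸ 4) % 5 + 2
  b = (M ∸ 4) / 5

  -- 94 = 71 + 23, where 23 Q bounds `C`. Then M - 4 ≥ 67 yields b ≥ 13.
  71≤M : 71 ≤ M
  71≤M = *-cancelʳ-≤ 71 M Q (+-cancelʳ-≤ (23 * Q) _ _ (begin
    71 * Q + 23 * Q  ≡⟨ *-distribʳ-+ Q 71 23 ⟨
    94 * Q           ≤⟨ 94Q≤k ⟩
    k                ≤⟨ m≤m+n k (7 * σ) ⟩
    k + 7 * σ        ≡⟨ z+C ⟨
    z + C            ≤⟨ +-mono-≤ (≤-reflexive z≡) C≤23Q ⟩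
    M * Q + 23 * Q   ∎))
    where open ≤-Reasoning

  M≡ : M ≡ 5 * b + a + 2
  M≡ = begin
    M                              ≡⟨ m+[n∸m]≡n (≤-trans (m≤m+n 4 67) 71≤M) ⟨
    4 + (M ∸ 4)                    ≡⟨ cong (4 +_) (m≡m%n+[m/n]*n (M ∸ 4) 5) ⟩
    4 + ((M ∸ 4) % 5 + b * 5)      ≡⟨ regroup ((M ∸ 4) % 5) b ⟩
    5 * b + a + 2                  ∎
    where
    open ≡-Reasoning
    regroup : ∀ r b → 4 + (r + b * 5) ≡ 5 * b + (r + 2) + 2
    regroup = solve-∀

  13≤b : 13 ≤ b
  13≤b = /-monoˡ-≤ {m = 67} 5 (∸-monoˡ-≤ 4 71≤M)

  2≤a : 2 ≤ a
  2≤a = m≤n+m 2 ((M ∸ 4) % 5)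

  a<7 : a < 7
  a<7 = +-monoˡ-< 2 (m%n<n (M ∸ 4) 5)

  a<b : a < b
  a<b = <-≤-trans a<7 (≤-trans (m≤m+n 7 6) 13≤b)

  -- In `z+C` the term 7 σ is at most 14 Q, k is at most 6 + T Q, and `6≤C` cancels the 6.
  M≤ : M ≤ T + 14
  M≤ = *-cancelʳ-≤ M (T + 14) Q (+-cancelˡ-≤ 6 _ _ (begin
    6 + M * Q                         ≤⟨ +-monoˡ-≤ (M * Q) (≤-trans 6≤C (m≤m+n C e)) ⟩
    C + e + M * Q                     ≡⟨ cong (C + e +_) z≡ ⟨
    C + e + z                         ≡⟨ regroup C e z ⟩
    z + C + e                         ≡⟨ cong (_+ e) z+C ⟩
    k + 7 * σ + e                     ≡⟨ swap k (7 * σ) e ⟩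
    k + e + 7 * σ                     ≡⟨ cong (_+ 7 * σ) k+e ⟩
    6 + T * Q + 7 * σ                 ≤⟨ +-monoʳ-≤ (6 + T * Q) (*-monoʳ-≤ 7 σ≤2Q) ⟩
    6 + T * Q + 7 * (2 * Q)           ≡⟨ collect T Q ⟩
    6 + (T + 14) * Q                  ∎))
    where
    open ≤-Reasoning
    regroup : ∀ C e z → C + e + z ≡ z + C + e
    regroup = solve-∀
    swap : ∀ k σ e → k + σ + e ≡ k + e + σ
    swap = solve-∀
    collect : ∀ T Q → 6 + T * Q + 7 * (2 * Q) ≡ 6 + (T + 14) * Q
    collect = solve-∀

  -- For l = T - b this is the condition 2 + 2 b ≤ l. It holds because T ≥ M - 14 ≥ 5 b - 10 and b ≥
  -- 13.
  2+3b≤T : 2 + (b + b) + b ≤ T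
  2+3b≤T = +-cancelʳ-≤ 14 _ _ (begin
    2 + (b + b) + b + 14           ≡⟨ regroup b ⟩
    3 * b + 16                     ≤⟨ +-monoʳ-≤ (3 * b) (≤-trans (m≤m+n 16 14) (+-monoˡ-≤ 4 (*-monoʳ-≤ 2 13≤b))) ⟩
    3 * b + (2 * b + 4)            ≡⟨ collect b ⟩
    5 * b + 2 + 2                  ≤⟨ +-monoˡ-≤ 2 (+-monoʳ-≤ (5 * b) 2≤a) ⟩
    5 * b + a + 2                  ≡⟨ M≡ ⟨
    M                              ≤⟨ M≤ ⟩
    T + 14                         ∎)
    where
    open ≤-Reasoning
    regroup : ∀ b → 2 + (b + b) + b + 14 ≡ 3 * b + 16
    regroup = solve-∀
    collect : ∀ b → 3 * b + (2 * b + 4) ≡ 5 * b + 2 + 2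
    collect = solve-∀

  b≤T : b ≤ T
  b≤T = ≤-trans (m≤n+m b (2 + (b + b))) 2+3b≤T

-- The two directions of the equivalence

module _ (Q k : ℕ) (2≤Q : 2 ≤ Q) where

  open DigitSum Q (≤-trans (s≤s z≤n) 2≤Q)

  necessary : InfinitelyManySolutions q k → Q ∣ k * (k ∸ 1)
  necessary solutions with solutions 0
  ... | n , _ , _ , _ , s-n² , s-n with s-residue n | s-residue (n * n)
  ...   | r , n≡ | r′ , n²≡ =
    -- Comparing n² = (k + Q r)² with n² = k + Q r′ gives Q (2 k r + Q r²) + k (k - 1) = Q r′.
    ∣m+n∣m⇒∣n
      (subst (Q ∣_) (sym (linear-combination
        (cong₂ _+_ (cong₂ _+_ n²≡k (sym (k*k≡k+k*[k∸1] k))) (sym (cong₂ _*_ n≡k n≡k)))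
        (identity k (k * (k ∸ 1)) Q r r′ n))) (m∣m*n r′))
      (m∣m*n (2 * k * r + Q * r * r))
    where
    n≡k : n ≡ k + Q * r
    n≡k = trans n≡ (cong (_+ Q * r) s-n)
    n²≡k : n * n ≡ k + Q * r′
    n²≡k = trans n²≡ (cong (_+ Q * r′) s-n²)
    identity : ∀ k w Q r r′ n →
      Q * (2 * k * r + Q * r * r) + w + (k + Q * r′ + k * k + n * n) ≡
      Q * r′ + (n * n + (k + w) + (k + Q * r) * (k + Q * r))
    identity = solve-∀

  module _ (94Q≤k : 94 * Q ≤ k) where

    instance
      nonZeroQ : NonZero Q
      nonZeroQ = >-nonZero (≤-trans (s≤s z≤n) 2≤Q)

    7≤k : 7 ≤ k
    7≤k = ≤-trans (m≤m+n 7 181) (≤-trans (*-monoʳ-≤ 94 2≤Q) 94Q≤k)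

    -- This makes ε = Q - r, which lies between 1 and Q and is congruent to 7 - k.
    r t e : ℕ
    r = (k ∸ 7) % Q
    t = (k ∸ 7) / Q
    e = Q ∸ suc r

    e+1+r : e + suc r ≡ Q
    e+1+r = m∸n+n≡m (m%n<n (k ∸ 7) Q)

    e<Q : e < Q
    e<Q = subst (e <_) e+1+r (m<m+n e z<s)

    open Construction Q 2≤Q e e<Q using (ε; σ; module Solution)

    -- Set beside `s-n`, it shows that s_q(n) = k amounts to l + b = suc t.
    k+e : k + e ≡ 6 + suc t * Q
    k+e = begin
      k + e                         ≡⟨ cong (_+ e) (m+[n∸m]≡n 7≤k) ⟨
      7 + (k ∸ 7) + e               ≡⟨ cong (λ x → 7 + x + e) (m≡m%n+[m/n]*n (k ∸ 7) Q) ⟩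
      7 + (r + t * Q) + e           ≡⟨ regroup r (t * Q) e ⟩
      6 + ((e + suc r) + t * Q)     ≡⟨ cong (λ x → 6 + (x + t * Q)) e+1+r ⟩
      6 + suc t * Q                 ∎
      where
      open ≡-Reasoning
      regroup : ∀ r t e → 7 + (r + t) + e ≡ 6 + (e + (1 + r) + t)
      regroup = solve-∀

    C : ℕ
    C = 36 + 2 * s q 3 + s q (ε * ε)

    6≤C : 6 ≤ C
    6≤C = ≤-trans (m≤m+n 6 30) (≤-trans (m≤m+n 36 (2 * s q 3)) (m≤m+n (36 + 2 * s q 3) (s q (ε * ε))))

    -- As Q ≥ 2, the three summands are at most 18 Q, 3 Q and 2 Q.
    C≤23Q : C ≤ 23 * Q
    C≤23Q = begin
      36 + 2 * s q 3 + s q (ε * ε)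
        ≤⟨ +-mono-≤ (+-mono-≤ (*-monoʳ-≤ 18 2≤Q) (≤-trans (*-monoʳ-≤ 2 (s≤ 3)) (*-monoʳ-≤ 3 2≤Q))) (s[m*m]≤2Q e<Q) ⟩
      18 * Q + 3 * Q + 2 * Q  ≡⟨ collect Q ⟩
      23 * Q ∎
      where
      open ≤-Reasoning
      collect : ∀ Q → 18 * Q + 3 * Q + 2 * Q ≡ 23 * Q
      collect = solve-∀

    σ≤2Q : σ ≤ 2 * Q
    σ≤2Q = begin
      σ              ≤⟨ s≤ (suc (2 * e)) ⟩
      suc (2 * e)    ≤⟨ n≤1+n (suc (2 * e)) ⟩
      2 + 2 * e      ≡⟨ *-suc 2 e ⟨
      2 * suc e      ≤⟨ *-monoʳ-≤ 2 e<Q ⟩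
      2 * Q          ∎
      where open ≤-Reasoning

    C≤k+7σ : C ≤ k + 7 * σ
    C≤k+7σ = begin
      C         ≤⟨ C≤23Q ⟩
      23 * Q    ≤⟨ *-monoˡ-≤ Q (m≤m+n 23 71) ⟩
      94 * Q    ≤⟨ 94Q≤k ⟩
      k         ≤⟨ m≤m+n k (7 * σ) ⟩
      k + 7 * σ ∎
      where open ≤-Reasoning

    -- The quotient `M` of `z` by `Q` fixes `a` and `b`, which settles the digit sum of n². Then l =
    -- suc t - b settles that of n, and `N` enters only through Y.
    solutions : ∀ {z} → z + C ≡ k + 7 * σ → Q ∣ z → InfinitelyManySolutions q k
    solutions {z} z+C (divides M z≡) N = n , N<n , ≤-<-trans z≤n N<n , q∤n ,
        +-cancelʳ-≡ (7 * σ) _ _ (begin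
          s q (n * n) + 7 * σ         ≡⟨ s-n² ⟩
          C + (5 * b + a + 2) * Q     ≡⟨ cong (λ x → C + x * Q) M≡ ⟨
          C + M * Q                   ≡⟨ cong (C +_) z≡ ⟨
          C + z                       ≡⟨ +-comm C z ⟩
          z + C                       ≡⟨ z+C ⟩
          k + 7 * σ                   ∎) ,
        +-cancelʳ-≡ e _ _ (begin
          s q n + e                   ≡⟨ s-n ⟩
          6 + (suc t ∸ b + b) * Q     ≡⟨ cong (λ x → 6 + x * Q) (m∸n+n≡m b≤T) ⟩
          6 + suc t * Q               ≡⟨ k+e ⟨
          k + e                       ∎)
      where
      open Parameters {Q} {k} {e} {z} {C} {σ} {suc t} {M} 94Q≤k k+e z+C z≡ 6≤C C≤23Q σ≤2Q
      open Solution a b (suc t ∸ b) N 2≤a a<b (≤-trans (m≤m+n 3 10) 13≤b)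
        (+-mono-≤ a<b (≤-trans (m≤m+n 2 11) 13≤b))
        (m+n≤o⇒m≤o∸n (2 + (b + b)) 2+3b≤T)
      open ≡-Reasoning

    sufficient : Q ∣ k * (k ∸ 1) → InfinitelyManySolutions q k
    sufficient Q∣k[k-1] =
      solutions z+C (Q∣k+7σ-C {Q} {k} {e} {_} {σ} {s q 3} {s q (ε * ε)} {suc t} Q∣k[k-1]
        (s-residue (suc (2 * e))) (s-residue 3) (s-residue (ε * ε)) k+e z+C)
      where
      z+C : k + 7 * σ ∸ C + C ≡ k + 7 * σ
      z+C = m∸n+n≡m C≤k+7σ

theorem1p5 : (q : ℕ) → .{{_ : NonZero q}} → 3 ≤ q → (k : ℕ) → 94 * (q ∸ 1) ≤ k →
    (InfinitelyManySolutions q k ⇔ ((q ∸ 1) ∣ k * (k ∸ 1)))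
theorem1p5 (suc Q) (s≤s 2≤Q) k 94Q≤k = mk⇔ (necessary Q k 2≤Q) (sufficient Q k 2≤Q 94Q≤k)
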